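{- GREEDY is a $\tfrac12$-approximation algorithm for one-red TAP: on every one-red TAP instance, the set of exemplars output by GREEDY has margin at least $\tfrac12$ times the maximum margin. In particular, GREEDY is a $\tfrac12$-approximation for $2$-weight TAP.
   Context: Target Approximation Problem (TAP): the input is a finite groundset $U$ of features, a target $T\subseteq U$, and a set $S$ of exemplars, each a subset of $U$. Features in $U\cap T$ are blue and features in $U\setminus T$ are red. For $S'\subseteq S$, a feature appears in $S'$ if it lies in at least one exemplar of $S'$; the margin of $S'$ is (number of blue features appearing in $S'$) minus (number of red features appearing in $S'$). Standing assumptions: every feature appears in at least one exemplar, and $T$ and all exemplars are nonempty. A TAP instance is one-red if every exemplar contains exactly one red feature; $2$-weight TAP means every exemplar has at most $2$ features. In a one-red instance, a red feature $r$ covers a blue feature $b$ if some exemplar contains both $r$ and $b$. GREEDY: until every blue feature is covered, repeatedly choose a red feature that covers the largest number of not-yet-covered blue features (ties broken arbitrarily); output the set of all exemplars whose red feature was chosen. -}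

module Defs where

open import Data.Nat using (ℕ; zero; suc; _≤_)
open import Data.Bool using (Bool; true; false; _∧_; _∨_)
open import Data.Fin using (Fin; zero; suc)
open import Data.Fin.Subset using (Subset; _∈_; _⊆_; _∩_; _∪_; ∁; ∣_∣; ⁅_⁆; ⊥)
open import Data.Integer using (ℤ; +_; _-_)
open import Data.List using (List; []; _∷_)
open import Data.Vec using (tabulate; lookup)
open import Relation.Nullary using (¬_)

-- A TAP instance: features U = Fin n, target T ⊆ U (blue = in T, red = not in T),
-- exemplars indexed by Fin m, exemplar e being the subset E e of U.

anyᵇ : ∀ k → (Fin k → Bool) → Bool
anyᵇ zero    p = false
anyᵇ (suc k) p = p zero ∨ anyᵇ k (λ i → p (suc i))

appearing : ∀ {n m} → (Fin m → Subset n) → Subset m → Subset n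
appearing {n} {m} E S' = tabulate (λ f → anyᵇ m (λ e → lookup S' e ∧ lookup (E e) f))

margin : ∀ {n m} → Subset n → (Fin m → Subset n) → Subset m → ℤ
margin T E S' = + ∣ appearing E S' ∩ T ∣ - + ∣ appearing E S' ∩ ∁ T ∣

StandingAssumptions : ∀ {n m} → Subset n → (Fin m → Subset n) → Set
StandingAssumptions {n} {m} T E =
  (∀ (f : Fin n) → Σ' (Fin m) (λ e → f ∈ E e))
  × (Σ' (Fin n) (λ f → f ∈ T))
  × (∀ (e : Fin m) → Σ' (Fin n) (λ f → f ∈ E e))
  where
  open import Data.Product using (_×_) renaming (Σ to Σ')

OneRed : ∀ {n m} → Subset n → (Fin m → Subset n) → Set
OneRed T E = ∀ e → ∣ E e ∩ ∁ T ∣ ≡ 1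
  where open import Relation.Binary.PropositionalEquality using (_≡_)

covSet : ∀ {n m} → Subset n → (Fin m → Subset n) → Fin n → Subset n
covSet {n} {m} T E r =
  tabulate (λ b → lookup T b ∧ anyᵇ m (λ e → lookup (E e) r ∧ lookup (E e) b))

gain : ∀ {n m} → Subset n → (Fin m → Subset n) → Subset n → Fin n → ℕ
gain T E C r = ∣ covSet T E r ∩ ∁ C ∣

-- GreedyFrom T E C rs : the list rs of red features is a possible (arbitrary tie-breaking)
-- continuation of a GREEDY run when the set of already covered blue features is C.
data GreedyFrom {n m} (T : Subset n) (E : Fin m → Subset n) (C : Subset n) : List (Fin n) → Set where
  done : T ⊆ C → GreedyFrom T E C []
  step : ∀ r rs →
         ¬ (T ⊆ C) →
         r ∈ ∁ T →
         (∀ r' → r' ∈ ∁ T → gain T E C r' ≤ gain T E C r) →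
         GreedyFrom T E (C ∪ covSet T E r) rs →
         GreedyFrom T E C (r ∷ rs)

GreedyRun : ∀ {n m} → Subset n → (Fin m → Subset n) → List (Fin n) → Set
GreedyRun T E rs = GreedyFrom T E ⊥ rs

chosen : ∀ {n} → List (Fin n) → Subset n
chosen []       = ⊥
chosen (r ∷ rs) = ⁅ r ⁆ ∪ chosen rs

greedyOutput : ∀ {n m} → Subset n → (Fin m → Subset n) → List (Fin n) → Subset m
greedyOutput {n} {m} T E rs =
  tabulate (λ e → anyᵇ n (λ f → lookup (E e ∩ ∁ T) f ∧ lookup (chosen rs) f))

-- Fix S' and let A be the features appearing in S'. Every exemplar has a red feature, so
-- the blue features of A are covered by the red features R of A. A GREEDY run of k steps
-- covers all of T and its output contains at most k red features, so it suffices to show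
-- ∣A ∩ T∣ + 2k ≤ 2∣T∣ + ∣R∣. This is proved along the run for the still uncovered blues:
-- a step of gain g ≥ 2 lowers 2∣uncovered T∣ by 2g ≥ 2 + g, which pays for the step and
-- for the at most g blues of A ∩ T it covers; once the maximal gain is at most 1, each red
-- of R covers at most one uncovered blue, while each remaining step still covers one.

module Submission where

open import Defs
open import Data.Nat using (ℕ)
open import Data.Fin using (Fin)
open import Data.Fin.Subset using (Subset; _∩_; ∁; ∣_∣)
open import Data.List using (List)

module OneRedGreedy where

  open import Data.Bool using (Bool; true; false; T; _∧_)
  open import Data.Bool.Properties using (T-∧; T-∨; T-≡)
  open import Data.Fin using (zero; suc; _≟_)
  open import Data.Fin.Properties using (⊎⇔∃)
  open import Data.Fin.Subset
    using (_∈_; _⊆_; _∪_; ⁅_⁆; ⊥; _-_; Nonempty)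
  open import Data.Fin.Subset.Properties
    using ( p⊆q⇒∣p∣≤∣q∣; x∈p∩q⁺; x∈p∩q⁻; x∈p∪q⁺; x∈p∪q⁻; ∣⊥∣≡0; ∣⁅x⁆∣≡1; x∈⁅x⁆; x∈⁅y⁆⇒x≡y; _∈?_
          ; x∉p⇒x∈∁p; x∈∁p⇒x∉p; x∉∁p⇒x∈p; ∉⊥; nonempty?; Empty-unique
          ; x∈p⇒∣p-x∣<∣p∣; x∈p∧x≢y⇒x∈p-y; ∩-assoc; ∩-identityʳ; ∪-∩-booleanAlgebra)
  import Algebra.Lattice.Properties.BooleanAlgebra as BooleanAlgebra
  open import Data.Integer as ℤ using (ℤ; +_)
  import Data.Integer.Properties as ℤ
  import Data.Integer.Tactic.RingSolver as ℤ-Solver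
  open import Data.List using ([]; _∷_; length)
  open import Data.Nat using (zero; suc; _+_; _*_; _≤_; _<_; z≤n; s≤s)
  open import Data.Nat.Properties hiding (_≟_)
  open import Data.Nat.Tactic.RingSolver using (solve-∀)
  open import Data.Product using (∃; _×_; _,_; proj₁; proj₂)
  import Data.Product.Function.Dependent.Propositional as Σ
  open import Data.Product.Function.NonDependent.Propositional using (_×-⇔_)
  open import Data.Sum using (_⊎_; inj₁; inj₂; [_,_]; map₁)
  open import Data.Sum.Function.Propositional using (_⊎-⇔_)
  open import Data.Vec using ([]; _∷_; lookup; tabulate; here; there)
  open import Data.Vec.Properties using ([]=⇒lookup; lookup⇒[]=; lookup∘tabulate)
  open import Function using (_∘_)
  open import Function.Bundles using (_⇔_; mk⇔; module Equivalence)
  import Function.Properties.Equivalence as ⇔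
  open import Function.Related.Propositional using (equivalence)
  open import Relation.Binary.PropositionalEquality hiding ([_])
  open import Relation.Nullary using (¬_; yes; no; contradiction)

  open Equivalence using (to; from)

  ∈⇔T-lookup : ∀ {n} {p : Subset n} {i} → i ∈ p ⇔ T (lookup p i)
  ∈⇔T-lookup {p = p} {i} =
    mk⇔ (from T-≡ ∘ []=⇒lookup) (lookup⇒[]= i p ∘ to T-≡)

  T-lookup-∧ : ∀ {n k} {p : Subset n} {q : Subset k} {i j} →
               T (lookup p i ∧ lookup q j) ⇔ (i ∈ p × j ∈ q)
  T-lookup-∧ = ⇔.trans T-∧ (⇔.sym ∈⇔T-lookup ×-⇔ ⇔.sym ∈⇔T-lookup)

  ∈-tabulate⇔ : ∀ {n} {f : Fin n → Bool} {i} → i ∈ tabulate f ⇔ T (f i)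
  ∈-tabulate⇔ {f = f} {i} = ⇔.trans ∈⇔T-lookup
    (mk⇔ (subst T (lookup∘tabulate f i)) (subst T (sym (lookup∘tabulate f i))))

  T-anyᵇ : ∀ k (p : Fin k → Bool) → T (anyᵇ k p) ⇔ ∃ λ i → T (p i)
  T-anyᵇ zero    p = mk⇔ (λ ()) (λ ())
  T-anyᵇ (suc k) p = ⇔.trans T-∨ (⇔.trans (⇔.refl ⊎-⇔ T-anyᵇ k (p ∘ suc)) ⊎⇔∃)

  ∈-appearing⇔ : ∀ {n m} {E : Fin m → Subset n} {S : Subset m} {f} →
                 f ∈ appearing E S ⇔ ∃ λ e → e ∈ S × f ∈ E e
  ∈-appearing⇔ {m = m} =
    ⇔.trans ∈-tabulate⇔ (⇔.trans (T-anyᵇ m _) (Σ.congˡ {k = equivalence} T-lookup-∧))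

  ∈-covSet⇔ : ∀ {n m} {T : Subset n} {E : Fin m → Subset n} {r b} →
              b ∈ covSet T E r ⇔ (b ∈ T × ∃ λ e → r ∈ E e × b ∈ E e)
  ∈-covSet⇔ {m = m} = ⇔.trans ∈-tabulate⇔ (⇔.trans T-∧
    (⇔.sym ∈⇔T-lookup ×-⇔ ⇔.trans (T-anyᵇ m _) (Σ.congˡ {k = equivalence} T-lookup-∧)))

  ∈-greedyOutput⇔ : ∀ {n m} {T : Subset n} {E : Fin m → Subset n} {rs e} →
                    e ∈ greedyOutput T E rs ⇔ ∃ λ f → f ∈ E e ∩ ∁ T × f ∈ chosen rs
  ∈-greedyOutput⇔ {n = n} =
    ⇔.trans ∈-tabulate⇔ (⇔.trans (T-anyᵇ n _) (Σ.congˡ {k = equivalence} T-lookup-∧))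

  ∣p∪q∣≤∣p∣+∣q∣ : ∀ {n} (p q : Subset n) → ∣ p ∪ q ∣ ≤ ∣ p ∣ + ∣ q ∣
  ∣p∪q∣≤∣p∣+∣q∣ []          []          = z≤n
  ∣p∪q∣≤∣p∣+∣q∣ (true  ∷ p) (true  ∷ q) = s≤s (≤-trans (∣p∪q∣≤∣p∣+∣q∣ p q) (+-monoʳ-≤ ∣ p ∣ (n≤1+n ∣ q ∣)))
  ∣p∪q∣≤∣p∣+∣q∣ (true  ∷ p) (false ∷ q) = s≤s (∣p∪q∣≤∣p∣+∣q∣ p q)
  ∣p∪q∣≤∣p∣+∣q∣ (false ∷ p) (true  ∷ q) = ≤-trans (s≤s (∣p∪q∣≤∣p∣+∣q∣ p q)) (≤-reflexive (sym (+-suc ∣ p ∣ ∣ q ∣)))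
  ∣p∪q∣≤∣p∣+∣q∣ (false ∷ p) (false ∷ q) = ∣p∪q∣≤∣p∣+∣q∣ p q

  ∣p∩q∣+∣p∩∁q∣≡∣p∣ : ∀ {n} (p q : Subset n) → ∣ p ∩ q ∣ + ∣ p ∩ ∁ q ∣ ≡ ∣ p ∣
  ∣p∩q∣+∣p∩∁q∣≡∣p∣ []          []          = refl
  ∣p∩q∣+∣p∩∁q∣≡∣p∣ (true  ∷ p) (true  ∷ q) = cong suc (∣p∩q∣+∣p∩∁q∣≡∣p∣ p q)
  ∣p∩q∣+∣p∩∁q∣≡∣p∣ (true  ∷ p) (false ∷ q) =
    trans (+-suc ∣ p ∩ q ∣ ∣ p ∩ ∁ q ∣) (cong suc (∣p∩q∣+∣p∩∁q∣≡∣p∣ p q))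
  ∣p∩q∣+∣p∩∁q∣≡∣p∣ (false ∷ p) (_     ∷ q) = ∣p∩q∣+∣p∩∁q∣≡∣p∣ p q

  ∣p∩∁q∩r∣+∣p∩∁[q∪r]∣≡∣p∩∁q∣ : ∀ {n} (p q r : Subset n) →
                               ∣ (p ∩ ∁ q) ∩ r ∣ + ∣ p ∩ ∁ (q ∪ r) ∣ ≡ ∣ p ∩ ∁ q ∣
  ∣p∩∁q∩r∣+∣p∩∁[q∪r]∣≡∣p∩∁q∣ {n} p q r = begin
    ∣ (p ∩ ∁ q) ∩ r ∣ + ∣ p ∩ ∁ (q ∪ r) ∣      ≡⟨ cong (λ s → ∣ (p ∩ ∁ q) ∩ r ∣ + ∣ p ∩ s ∣) (deMorgan₂ q r) ⟩
    ∣ (p ∩ ∁ q) ∩ r ∣ + ∣ p ∩ (∁ q ∩ ∁ r) ∣    ≡⟨ cong (λ s → ∣ (p ∩ ∁ q) ∩ r ∣ + ∣ s ∣) (∩-assoc p (∁ q) (∁ r)) ⟨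
    ∣ (p ∩ ∁ q) ∩ r ∣ + ∣ (p ∩ ∁ q) ∩ ∁ r ∣    ≡⟨ ∣p∩q∣+∣p∩∁q∣≡∣p∣ (p ∩ ∁ q) r ⟩
    ∣ p ∩ ∁ q ∣                                ∎
    where
    open ≡-Reasoning
    open BooleanAlgebra (∪-∩-booleanAlgebra n) using (deMorgan₂)

  ∣p∩∁⊥∣≡∣p∣ : ∀ {n} (p : Subset n) → ∣ p ∩ ∁ ⊥ ∣ ≡ ∣ p ∣
  ∣p∩∁⊥∣≡∣p∣ {n} p = cong ∣_∣ (trans (cong (p ∩_) ¬⊥≈⊤) (∩-identityʳ p))
    where open BooleanAlgebra (∪-∩-booleanAlgebra n) using (¬⊥≈⊤)

  x∈p⇒0<∣p∣ : ∀ {n} {p : Subset n} {x} → x ∈ p → 0 < ∣ p ∣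
  x∈p⇒0<∣p∣ x∈p = ≤-<-trans z≤n (x∈p⇒∣p-x∣<∣p∣ x∈p)

  0<∣p∣⇒Nonempty : ∀ {n} (p : Subset n) → 0 < ∣ p ∣ → Nonempty p
  0<∣p∣⇒Nonempty {n} p 0<∣p∣ with nonempty? p
  ... | yes ne = ne
  ... | no ¬ne = contradiction (trans (cong ∣_∣ (Empty-unique ¬ne)) (∣⊥∣≡0 n)) (m<n⇒n≢0 0<∣p∣)

  ∣p∣≡1⇒∈-unique : ∀ {n} {p : Subset n} {x y} → ∣ p ∣ ≡ 1 → x ∈ p → y ∈ p → x ≡ y
  ∣p∣≡1⇒∈-unique {p = p} {x} {y} ∣p∣≡1 x∈p y∈p with x ≟ y
  ... | yes x≡y = x≡y
  ... | no  x≢y = contradiction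
    (n<1⇒n≡0 (subst (∣ p - y ∣ <_) ∣p∣≡1 (x∈p⇒∣p-x∣<∣p∣ y∈p)))
    (m<n⇒n≢0 (x∈p⇒0<∣p∣ (x∈p∧x≢y⇒x∈p-y x∈p x≢y)))

  ⊈⇒Nonempty[p∩∁q] : ∀ {n} {p q : Subset n} → ¬ (p ⊆ q) → Nonempty (p ∩ ∁ q)
  ⊈⇒Nonempty[p∩∁q] {p = p} {q} p⊈q with nonempty? (p ∩ ∁ q)
  ... | yes ne  = ne
  ... | no  ¬ne = contradiction (λ {x} x∈p → x∉∁p⇒x∈p (λ x∈∁q → ¬ne (_ , x∈p∩q⁺ (x∈p , x∈∁q)))) p⊈q

  appearing-∷⁻ : ∀ {n m} {E : Fin (suc m) → Subset n} {s S f} → f ∈ appearing E (s ∷ S) →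
                 (zero ∈ s ∷ S × f ∈ E zero) ⊎ f ∈ appearing (E ∘ suc) S
  appearing-∷⁻ {E = E} {s} {S} f∈ with to (∈-appearing⇔ {E = E} {s ∷ S}) f∈
  ... | zero  , z∈S       , f∈E = inj₁ (z∈S , f∈E)
  ... | suc e , there e∈S , f∈E = inj₂ (from (∈-appearing⇔ {E = E ∘ suc} {S}) (e , e∈S , f∈E))

  ∣appearing∣≤∣S∣ : ∀ {n m} (E : Fin m → Subset n) (S : Subset m) →
                   (∀ {e} → e ∈ S → ∣ E e ∣ ≤ 1) → ∣ appearing E S ∣ ≤ ∣ S ∣
  ∣appearing∣≤∣S∣ {n} E [] _ = ≤-trans (p⊆q⇒∣p∣≤∣q∣ nothing-appears) (≤-reflexive (∣⊥∣≡0 n))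
    where
    nothing-appears : appearing E [] ⊆ ⊥
    nothing-appears f∈ with to (∈-appearing⇔ {E = E} {[]}) f∈
    ... | () , _
  ∣appearing∣≤∣S∣ E (true ∷ S) small = begin
    ∣ appearing E (true ∷ S) ∣               ≤⟨ p⊆q⇒∣p∣≤∣q∣ (x∈p∪q⁺ ∘ map₁ proj₂ ∘ appearing-∷⁻ {E = E} {true} {S}) ⟩
    ∣ E zero ∪ appearing (E ∘ suc) S ∣       ≤⟨ ∣p∪q∣≤∣p∣+∣q∣ (E zero) _ ⟩
    ∣ E zero ∣ + ∣ appearing (E ∘ suc) S ∣   ≤⟨ +-mono-≤ (small here) (∣appearing∣≤∣S∣ (E ∘ suc) S (small ∘ there)) ⟩
    1 + ∣ S ∣                                ∎
    where open ≤-Reasoning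
  ∣appearing∣≤∣S∣ E (false ∷ S) small =
    ≤-trans (p⊆q⇒∣p∣≤∣q∣ only-later) (∣appearing∣≤∣S∣ (E ∘ suc) S (small ∘ there))
    where
    only-later : appearing E (false ∷ S) ⊆ appearing (E ∘ suc) S
    only-later f∈ with appearing-∷⁻ {E = E} {false} {S} f∈
    ... | inj₁ (() , _)
    ... | inj₂ f∈′ = f∈′

  ∣chosen∣≤length : ∀ {n} (rs : List (Fin n)) → ∣ chosen rs ∣ ≤ length rs
  ∣chosen∣≤length {n} []       = ≤-reflexive (∣⊥∣≡0 n)
  ∣chosen∣≤length      (r ∷ rs) = begin
    ∣ ⁅ r ⁆ ∪ chosen rs ∣     ≤⟨ ∣p∪q∣≤∣p∣+∣q∣ ⁅ r ⁆ (chosen rs) ⟩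
    ∣ ⁅ r ⁆ ∣ + ∣ chosen rs ∣ ≤⟨ +-mono-≤ (≤-reflexive (∣⁅x⁆∣≡1 r)) (∣chosen∣≤length rs) ⟩
    1 + length rs            ∎
    where open ≤-Reasoning

  +a-+b≤2[+c-+d] : ∀ a b c d → a + 2 * d ≤ 2 * c + b → + a ℤ.- + b ℤ.≤ + 2 ℤ.* (+ c ℤ.- + d)
  +a-+b≤2[+c-+d] a b c d ineq = ℤ.0≤i-j⇒j≤i (subst (ℤ.0ℤ ℤ.≤_) difference (ℤ.i≤j⇒0≤j-i (ℤ.+≤+ ineq)))
    where
    regroup : ∀ (a b c d : ℤ) → (+ 2 ℤ.* c ℤ.+ b) ℤ.- (a ℤ.+ + 2 ℤ.* d) ≡ + 2 ℤ.* (c ℤ.- d) ℤ.- (a ℤ.- b)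
    regroup = ℤ-Solver.solve-∀
    difference : + (2 * c + b) ℤ.- + (a + 2 * d) ≡ + 2 ℤ.* (+ c ℤ.- + d) ℤ.- (+ a ℤ.- + b)
    difference = begin
      + (2 * c + b) ℤ.- + (a + 2 * d)                 ≡⟨ cong₂ ℤ._-_ (ℤ.pos-+ (2 * c) b) (ℤ.pos-+ a (2 * d)) ⟩
      (+ (2 * c) ℤ.+ + b) ℤ.- (+ a ℤ.+ + (2 * d))     ≡⟨ cong₂ (λ x y → (x ℤ.+ + b) ℤ.- (+ a ℤ.+ y)) (ℤ.pos-* 2 c) (ℤ.pos-* 2 d) ⟩
      (+ 2 ℤ.* + c ℤ.+ + b) ℤ.- (+ a ℤ.+ + 2 ℤ.* + d) ≡⟨ regroup (+ a) (+ b) (+ c) (+ d) ⟩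
      + 2 ℤ.* (+ c ℤ.- + d) ℤ.- (+ a ℤ.- + b)         ∎
      where open ≡-Reasoning

  module GreedyAnalysis {n m : ℕ} (T : Subset n) (E : Fin m → Subset n) where

    Covers : Subset n → Subset n → Set
    Covers R X = ∀ {b} → b ∈ X → ∃ λ r → r ∈ R × b ∈ covSet T E r

    covSet⊆T : ∀ r → covSet T E r ⊆ T
    covSet⊆T r = proj₁ ∘ to (∈-covSet⇔ {T = T} {E} {r})

    red-covers-exemplar : OneRed T E → ∀ e {b} → b ∈ T → b ∈ E e →
                          ∃ λ r → r ∈ E e ∩ ∁ T × b ∈ covSet T E r
    red-covers-exemplar one-red e b∈T b∈E
      with 0<∣p∣⇒Nonempty (E e ∩ ∁ T) (≤-reflexive (sym (one-red e)))
    ... | r , r∈ = r , r∈ , from (∈-covSet⇔ {T = T} {E}) (b∈T , e , proj₁ (x∈p∩q⁻ _ _ r∈) , b∈E)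

    OneRed⇒Covers-appearing : OneRed T E → ∀ S → Covers (appearing E S ∩ ∁ T) (appearing E S ∩ T)
    OneRed⇒Covers-appearing one-red S b∈ with x∈p∩q⁻ _ _ b∈
    ... | b∈A , b∈T with to (∈-appearing⇔ {E = E} {S}) b∈A
    ... | e , e∈S , b∈E with red-covers-exemplar one-red e b∈T b∈E
    ... | r , r∈ , b∈cov with x∈p∩q⁻ _ _ r∈
    ... | r∈E , r∈∁T = r , x∈p∩q⁺ (from (∈-appearing⇔ {E = E} {S}) (e , e∈S , r∈E) , r∈∁T) , b∈cov

    Standing⇒Covers[∁T,T] : StandingAssumptions T E → OneRed T E → Covers (∁ T) T
    Standing⇒Covers[∁T,T] (appears , _ , _) one-red {b} b∈T with appears b
    ... | e , b∈E with red-covers-exemplar one-red e b∈T b∈E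
    ... | r , r∈ , b∈cov = r , proj₂ (x∈p∩q⁻ _ _ r∈) , b∈cov

    uncovered-targets-drop-by-gain : ∀ C r → gain T E C r + ∣ T ∩ ∁ (C ∪ covSet T E r) ∣ ≤ ∣ T ∩ ∁ C ∣
    uncovered-targets-drop-by-gain C r = begin
      gain T E C r + ∣ T ∩ ∁ (C ∪ covSet T E r) ∣              ≤⟨ +-monoˡ-≤ _ (p⊆q⇒∣p∣≤∣q∣ newly⊆) ⟩
      ∣ (T ∩ ∁ C) ∩ covSet T E r ∣ + ∣ T ∩ ∁ (C ∪ covSet T E r) ∣ ≡⟨ ∣p∩∁q∩r∣+∣p∩∁[q∪r]∣≡∣p∩∁q∣ T C (covSet T E r) ⟩
      ∣ T ∩ ∁ C ∣                                              ∎
      where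
      open ≤-Reasoning
      newly⊆ : covSet T E r ∩ ∁ C ⊆ (T ∩ ∁ C) ∩ covSet T E r
      newly⊆ x∈ with x∈p∩q⁻ _ _ x∈
      ... | x∈cov , x∈∁C = x∈p∩q⁺ (x∈p∩q⁺ (covSet⊆T r x∈cov , x∈∁C) , x∈cov)

    uncovered-drops-by-at-most-gain : ∀ X C r → ∣ X ∩ ∁ C ∣ ≤ gain T E C r + ∣ X ∩ ∁ (C ∪ covSet T E r) ∣
    uncovered-drops-by-at-most-gain X C r = begin
      ∣ X ∩ ∁ C ∣                                              ≡⟨ ∣p∩∁q∩r∣+∣p∩∁[q∪r]∣≡∣p∩∁q∣ X C (covSet T E r) ⟨
      ∣ (X ∩ ∁ C) ∩ covSet T E r ∣ + ∣ X ∩ ∁ (C ∪ covSet T E r) ∣ ≤⟨ +-monoˡ-≤ _ (p⊆q⇒∣p∣≤∣q∣ removed⊆) ⟩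
      gain T E C r + ∣ X ∩ ∁ (C ∪ covSet T E r) ∣              ∎
      where
      open ≤-Reasoning
      removed⊆ : (X ∩ ∁ C) ∩ covSet T E r ⊆ covSet T E r ∩ ∁ C
      removed⊆ x∈ with x∈p∩q⁻ _ _ x∈
      ... | x∈X∩∁C , x∈cov = x∈p∩q⁺ (x∈cov , proj₂ (x∈p∩q⁻ _ _ x∈X∩∁C))

    unit-gains⇒∣X∩∁C∣≤∣R∣ : ∀ {C R X} → (∀ {r} → r ∈ R → gain T E C r ≤ 1) → Covers R X →
                            ∣ X ∩ ∁ C ∣ ≤ ∣ R ∣
    unit-gains⇒∣X∩∁C∣≤∣R∣ {C} {R} {X} unit covers =
      ≤-trans (p⊆q⇒∣p∣≤∣q∣ ⊆newly) (∣appearing∣≤∣S∣ newly R unit)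
      where
      newly : Fin n → Subset n
      newly r = covSet T E r ∩ ∁ C
      ⊆newly : X ∩ ∁ C ⊆ appearing newly R
      ⊆newly b∈ with x∈p∩q⁻ _ _ b∈
      ... | b∈X , b∈∁C with covers b∈X
      ... | r , r∈R , b∈cov = from (∈-appearing⇔ {E = newly} {R}) (r , r∈R , x∈p∩q⁺ (b∈cov , b∈∁C))

    greedy-gain-positive : ∀ {C r} → Covers (∁ T) T → ¬ (T ⊆ C) →
                           (∀ r′ → r′ ∈ ∁ T → gain T E C r′ ≤ gain T E C r) → 0 < gain T E C r
    greedy-gain-positive {C} covers-T T⊈C maximal with ⊈⇒Nonempty[p∩∁q] T⊈C
    ... | b , b∈ with x∈p∩q⁻ _ _ b∈
    ... | b∈T , b∈∁C with covers-T b∈T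
    ... | r′ , r′∈∁T , b∈cov = <-≤-trans (x∈p⇒0<∣p∣ (x∈p∩q⁺ (b∈cov , b∈∁C))) (maximal r′ r′∈∁T)

    greedy-length≤uncovered : ∀ {C rs} → Covers (∁ T) T → GreedyFrom T E C rs → length rs ≤ ∣ T ∩ ∁ C ∣
    greedy-length≤uncovered covers-T (done _) = z≤n
    greedy-length≤uncovered covers-T (step r rs T⊈C _ maximal rest) =
      ≤-trans (+-mono-≤ (greedy-gain-positive covers-T T⊈C maximal) (greedy-length≤uncovered covers-T rest))
              (uncovered-targets-drop-by-gain _ r)

    greedy-bound : ∀ {C rs R X} → Covers (∁ T) T → GreedyFrom T E C rs → R ⊆ ∁ T → Covers R X →
                   ∣ X ∩ ∁ C ∣ + 2 * length rs ≤ 2 * ∣ T ∩ ∁ C ∣ + ∣ R ∣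
    greedy-bound {C} {X = X} covers-T (done T⊆C) R⊆∁T covers-X =
      ≤-trans (+-monoˡ-≤ (2 * 0) (≤-trans (p⊆q⇒∣p∣≤∣q∣ nothing-uncovered) (≤-reflexive (∣⊥∣≡0 n)))) z≤n
      where
      nothing-uncovered : X ∩ ∁ C ⊆ ⊥
      nothing-uncovered b∈ with x∈p∩q⁻ _ _ b∈
      ... | b∈X , b∈∁C with covers-X b∈X
      ... | _ , _ , b∈cov = contradiction (T⊆C (covSet⊆T _ b∈cov)) (x∈∁p⇒x∉p b∈∁C)
    greedy-bound {C} {R = R} {X} covers-T run@(step r rs T⊈C _ maximal rest) R⊆∁T covers-X
      with 2 ≤? gain T E C r
    ... | yes 2≤g = begin
      x + 2 * suc k              ≤⟨ +-monoˡ-≤ _ (uncovered-drops-by-at-most-gain X C r) ⟩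
      (g + x′) + 2 * suc k       ≡⟨ regroup₁ g x′ k ⟩
      (x′ + 2 * k) + (g + 2)     ≤⟨ +-mono-≤ (greedy-bound covers-T rest R⊆∁T covers-X) (+-monoʳ-≤ g 2≤g) ⟩
      (2 * t′ + ∣ R ∣) + (g + g) ≡⟨ regroup₂ g t′ ∣ R ∣ ⟩
      2 * (g + t′) + ∣ R ∣       ≤⟨ +-monoˡ-≤ ∣ R ∣ (*-monoʳ-≤ 2 (uncovered-targets-drop-by-gain C r)) ⟩
      2 * ∣ T ∩ ∁ C ∣ + ∣ R ∣    ∎
      where
      open ≤-Reasoning
      g = gain T E C r
      k = length rs
      x = ∣ X ∩ ∁ C ∣
      x′ = ∣ X ∩ ∁ (C ∪ covSet T E r) ∣
      t′ = ∣ T ∩ ∁ (C ∪ covSet T E r) ∣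
      regroup₁ : ∀ g x′ k → (g + x′) + 2 * suc k ≡ (x′ + 2 * k) + (g + 2)
      regroup₁ = solve-∀
      regroup₂ : ∀ g t′ l → (2 * t′ + l) + (g + g) ≡ 2 * (g + t′) + l
      regroup₂ = solve-∀
    ... | no g≱2 =
      ≤-trans (+-mono-≤ (unit-gains⇒∣X∩∁C∣≤∣R∣ unit covers-X) (*-monoʳ-≤ 2 (greedy-length≤uncovered covers-T run)))
              (≤-reflexive (+-comm ∣ R ∣ _))
      where
      unit : ∀ {r′} → r′ ∈ R → gain T E C r′ ≤ 1
      unit r′∈R = ≤-trans (maximal _ (R⊆∁T r′∈R)) (≤-pred (≰⇒> g≱2))

    greedy-chosen⊆∁T : ∀ {C rs} → GreedyFrom T E C rs → chosen rs ⊆ ∁ T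
    greedy-chosen⊆∁T (done _) x∈ = contradiction x∈ ∉⊥
    greedy-chosen⊆∁T (step r rs _ r∈∁T _ rest) x∈ with x∈p∪q⁻ ⁅ r ⁆ (chosen rs) x∈
    ... | inj₁ x∈⁅r⁆ = subst (_∈ ∁ T) (sym (x∈⁅y⁆⇒x≡y r x∈⁅r⁆)) r∈∁T
    ... | inj₂ x∈rs = greedy-chosen⊆∁T rest x∈rs

    greedy-covers : ∀ {C rs} → GreedyFrom T E C rs → Covers (chosen rs) (T ∩ ∁ C)
    greedy-covers (done T⊆C) b∈ with x∈p∩q⁻ _ _ b∈
    ... | b∈T , b∈∁C = contradiction (T⊆C b∈T) (x∈∁p⇒x∉p b∈∁C)
    greedy-covers {C} (step r rs _ _ _ rest) {b} b∈ with b ∈? covSet T E r | x∈p∩q⁻ _ _ b∈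
    ... | yes b∈cov | _          = r , x∈p∪q⁺ (inj₁ (x∈⁅x⁆ r)) , b∈cov
    ... | no  b∉cov | b∈T , b∈∁C =
      let still-uncovered = x∉p⇒x∈∁p ([ x∈∁p⇒x∉p b∈∁C , b∉cov ] ∘ x∈p∪q⁻ C (covSet T E r))
          r′ , r′∈rs , b∈cov = greedy-covers rest (x∈p∩q⁺ (b∈T , still-uncovered))
      in  r′ , x∈p∪q⁺ (inj₂ r′∈rs) , b∈cov

    T⊆appearing-greedyOutput : ∀ {rs} → GreedyRun T E rs → T ⊆ appearing E (greedyOutput T E rs)
    T⊆appearing-greedyOutput {rs} run b∈T with greedy-covers run (x∈p∩q⁺ (b∈T , x∉p⇒x∈∁p ∉⊥))
    ... | r , r∈rs , b∈cov with to (∈-covSet⇔ {T = T} {E}) b∈cov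
    ... | _ , e , r∈E , b∈E = from (∈-appearing⇔ {E = E} {greedyOutput T E rs})
      (e , from (∈-greedyOutput⇔ {T = T} {E} {rs}) (r , x∈p∩q⁺ (r∈E , greedy-chosen⊆∁T run r∈rs) , r∈rs) , b∈E)

    appearing-greedyOutput∩∁T⊆chosen : ∀ rs → OneRed T E → appearing E (greedyOutput T E rs) ∩ ∁ T ⊆ chosen rs
    appearing-greedyOutput∩∁T⊆chosen rs one-red f∈ with x∈p∩q⁻ _ _ f∈
    ... | f∈A , f∈∁T with to (∈-appearing⇔ {E = E} {greedyOutput T E rs}) f∈A
    ... | e , e∈G , f∈E with to (∈-greedyOutput⇔ {T = T} {E} {rs}) e∈G
    ... | f′ , f′∈ , f′∈rs = subst (_∈ chosen rs) (∣p∣≡1⇒∈-unique (one-red e) f′∈ (x∈p∩q⁺ (f∈E , f∈∁T))) f′∈rs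

    greedy-margin-budget : StandingAssumptions T E → OneRed T E → ∀ {rs} → GreedyRun T E rs → ∀ S →
                           let A = appearing E S ; G = appearing E (greedyOutput T E rs) in
                           ∣ A ∩ T ∣ + 2 * ∣ G ∩ ∁ T ∣ ≤ 2 * ∣ G ∩ T ∣ + ∣ A ∩ ∁ T ∣
    greedy-margin-budget standing one-red {rs} run S = begin
      ∣ A ∩ T ∣ + 2 * ∣ G ∩ ∁ T ∣            ≤⟨ +-monoʳ-≤ ∣ A ∩ T ∣ (*-monoʳ-≤ 2 greedy-reds) ⟩
      ∣ A ∩ T ∣ + 2 * length rs              ≡⟨ cong (_+ 2 * length rs) (∣p∩∁⊥∣≡∣p∣ (A ∩ T)) ⟨
      ∣ (A ∩ T) ∩ ∁ ⊥ ∣ + 2 * length rs      ≤⟨ greedy-bound covers-T run (proj₂ ∘ x∈p∩q⁻ A (∁ T)) (OneRed⇒Covers-appearing one-red S) ⟩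
      2 * ∣ T ∩ ∁ ⊥ ∣ + ∣ A ∩ ∁ T ∣          ≡⟨ cong (λ t → 2 * t + ∣ A ∩ ∁ T ∣) (∣p∩∁⊥∣≡∣p∣ T) ⟩
      2 * ∣ T ∣ + ∣ A ∩ ∁ T ∣                ≤⟨ +-monoˡ-≤ ∣ A ∩ ∁ T ∣ (*-monoʳ-≤ 2 greedy-blues) ⟩
      2 * ∣ G ∩ T ∣ + ∣ A ∩ ∁ T ∣            ∎
      where
      open ≤-Reasoning
      A = appearing E S
      G = appearing E (greedyOutput T E rs)
      covers-T = Standing⇒Covers[∁T,T] standing one-red
      greedy-reds : ∣ G ∩ ∁ T ∣ ≤ length rs
      greedy-reds = ≤-trans (p⊆q⇒∣p∣≤∣q∣ (appearing-greedyOutput∩∁T⊆chosen rs one-red)) (∣chosen∣≤length rs)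
      greedy-blues : ∣ T ∣ ≤ ∣ G ∩ T ∣
      greedy-blues = p⊆q⇒∣p∣≤∣q∣ (λ b∈T → x∈p∩q⁺ (T⊆appearing-greedyOutput run b∈T , b∈T))

-- ℤ's _≤_ and _*_ are opened only here: inside OneRedGreedy they would clash with ℕ's.
open import Data.Integer using (ℤ; +_; _*_; _≤_)
open OneRedGreedy using (module GreedyAnalysis; +a-+b≤2[+c-+d])

theorem6p2 : ∀ {n m : ℕ} (T : Subset n) (E : Fin m → Subset n) →
    StandingAssumptions T E → OneRed T E →
    (rs : List (Fin n)) → GreedyRun T E rs →
    (S' : Subset m) → margin T E S' ≤ (+ 2) * margin T E (greedyOutput T E rs)
theorem6p2 T E standing one-red rs run S' =
  +a-+b≤2[+c-+d] (∣ A ∩ T ∣) (∣ A ∩ ∁ T ∣) (∣ G ∩ T ∣) (∣ G ∩ ∁ T ∣)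
    (GreedyAnalysis.greedy-margin-budget T E standing one-red run S')
  where
  A = appearing E S'
  G = appearing E (greedyOutput T E rs)
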